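{- Let $n,k,r$ be integers with $k,r\geq 2$ and $n\geq k+1$. If $H$ is a vertex-$k$-maximal $r$-uniform hypergraph on $n$ vertices, then $|E(H)|\geq \binom{n}{r}-\binom{n-k}{r}$.
   Context: Binomial coefficients satisfy $\binom{a}{b}=0$ when $b>a$. A hypergraph $H=(V,E)$ consists of a finite vertex set $V$ and a set $E$ of non-empty subsets of $V$ (edges); it is $r$-uniform if all edges have exactly $r$ elements. The complement $H^c$ has as edges the $r$-subsets of $V$ not in $E$. A subhypergraph is $H'=(V',E')$ with $V'\subseteq V$, $E'\subseteq E$. $H+e=(V,E\cup\{e\})$ for $e\in E(H^c)$. $H-Y$ is the hypergraph induced on $V\setminus Y$ (keeping edges contained in $V\setminus Y$). Connectedness is defined via paths (alternating sequences of distinct vertices and distinct edges with consecutive vertices in the intermediate edge). A vertex-cut is a set $X$ with $H-X$ disconnected. $\kappa(H)$ is the minimum size of a vertex-cut if one exists, and $|V(H)|-1$ otherwise. $\overline{\kappa}(H)=\max\{\kappa(H'): H'\subseteq H\}$. An $r$-uniform hypergraph $H$ is vertex-$k$-maximal if $\overline{\kappa}(H)\leq k$ but $\overline{\kappa}(H+e)\geq k+1$ for every $e\in E(H^c)$. -}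

module Defs where

open import Data.Bool.Properties using () renaming (_≟_ to _≟ᵇ_)
open import Data.Fin using (Fin; zero; suc)
open import Data.Fin.Properties using (all?; injective⇒≤) renaming (_≟_ to _≟ᶠ_)
open import Data.Fin.Subset using (Subset; inside; outside; _∈_; _⊆_; _∩_; _─_; ∣_∣; Nonempty)
open import Data.Fin.Subset.Properties
  using (_∈?_; _⊆?_; anySubset?; ⊆-antisym; ⊆-trans; ∣p∣≤n; p∩q⊆p; p∩q⊆q; x∈p∩q⁺)
open import Data.List using (List; []; _∷_; length; filter; lookup; allFin)
open import Data.List.Properties using (filter-accept; filter-reject)
open import Data.List.Membership.Propositional using (find; lose) renaming (_∈_ to _∈ᴸ_; _∉_ to _∉ᴸ_)
open import Data.List.Membership.Propositional.Properties using (∈-filter⁺; ∈-filter⁻; ∈-allFin; ∈-lookup)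
import Data.List.Membership.DecPropositional as DecMembership
open import Data.List.Relation.Binary.Subset.Propositional using () renaming (_⊆_ to _⊆ᴸ_)
open import Data.List.Relation.Unary.All as All using (All; []; _∷_)
open import Data.List.Relation.Unary.All.Properties using (¬Any⇒All¬; all-filter; filter⁺)
open import Data.List.Relation.Unary.Any using (any?)
open import Data.List.Relation.Unary.AllPairs using (_∷_)
open import Data.List.Relation.Unary.Unique.Propositional using (Unique)
import Data.List.Relation.Unary.Unique.Propositional.Properties as Unique
import Data.List.Relation.Unary.Unique.DecPropositional as DecUnique
open import Data.Nat using (ℕ; zero; suc; _≤_; _≥_; _∸_; z≤n; s≤s)
import Data.Nat.Properties as ℕ
open import Data.Product using (∃; ∃₂; _×_; _,_; proj₁; proj₂)
open import Data.Sum using (_⊎_; inj₁; inj₂)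
open import Data.Vec using () renaming ([] to []ᵛ; _∷_ to _∷ᵛ_)
open import Data.Vec.Properties using (≡-dec)
open import Function using (_∘_)
open import Relation.Binary.Definitions using (DecidableEquality)
open import Relation.Binary.PropositionalEquality using (_≡_; refl; sym; trans; cong)
open import Relation.Nullary using (¬_; Dec; yes; no; contradiction)
open import Relation.Nullary.Decidable using (_×-dec_; _→-dec_; ¬?; map′)
open import Relation.Unary using (Decidable)

private
  variable
    N : ℕ

-- Vertices are drawn from an ambient finite set Fin N, of which the vertex set
-- is an arbitrary subset, so that a hypergraph and its subhypergraphs have the
-- same type.  The edge set is a repetition-free list; its order is irrelevant.
record Hypergraph (N : ℕ) : Set where
  field
    V          : Subset N
    E          : List (Subset N)
    E-unique   : Unique E
    E-nonempty : All Nonempty E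
    E-within   : All (_⊆ V) E

open Hypergraph public

Uniform : ℕ → Hypergraph N → Set
Uniform r H = All (λ e → ∣ e ∣ ≡ r) (E H)

infix 4 _⊑_
_⊑_ : Hypergraph N → Hypergraph N → Set
H′ ⊑ H = V H′ ⊆ V H × E H′ ⊆ᴸ E H

-- Edges of Hᶜ.  For r ≥ 1 the nonemptiness is implied by the size.
record ComplementEdge (r : ℕ) (H : Hypergraph N) (e : Subset N) : Set where
  field
    nonempty : Nonempty e
    within   : e ⊆ V H
    size     : ∣ e ∣ ≡ r
    new      : e ∉ᴸ E H

addEdge : ∀ {r} (H : Hypergraph N) (e : Subset N) → ComplementEdge r H e → Hypergraph N
addEdge H e c = record
  { V          = V H
  ; E          = e ∷ E H
  ; E-unique   = ¬Any⇒All¬ (E H) new ∷ E-unique H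
  ; E-nonempty = nonempty ∷ E-nonempty H
  ; E-within   = within ∷ E-within H
  }
  where open ComplementEdge c

infixl 6 _-ᵛ_
_-ᵛ_ : Hypergraph N → Subset N → Hypergraph N
H -ᵛ Y = record
  { V          = V H ─ Y
  ; E          = filter (_⊆? (V H ─ Y)) (E H)
  ; E-unique   = Unique.filter⁺ _ (E-unique H)
  ; E-nonempty = filter⁺ _ (E-nonempty H)
  ; E-within   = all-filter _ (E H)
  }

-- The third and fourth indices list the vertices and the edges traversed.
data Walk (H : Hypergraph N) : Fin N → Fin N → List (Fin N) → List (Subset N) → Set where
  stop : ∀ {v} → v ∈ V H → Walk H v v (v ∷ []) []
  step : ∀ {u w v e vs es} → e ∈ᴸ E H → u ∈ e → w ∈ e →
         Walk H w v vs es → Walk H u v (u ∷ vs) (e ∷ es)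

Path : Hypergraph N → Fin N → Fin N → Set
Path H u v = ∃₂ λ vs es → Walk H u v vs es × Unique vs × Unique es

-- A hypergraph with at most one vertex is connected, so every vertex-cut leaves
-- at least two vertices.
Connected : Hypergraph N → Set
Connected H = ∀ u v → u ∈ V H → v ∈ V H → Path H u v

IsVertexCut : Hypergraph N → Subset N → Set
IsVertexCut H X = X ⊆ V H × ¬ Connected (H -ᵛ X)

-- κ(H) is the number m with this property; existence and uniqueness are shown
-- below.
IsConnectivity : Hypergraph N → ℕ → Set
IsConnectivity H m =
    ((∃ λ X → IsVertexCut H X × ∣ X ∣ ≡ m) × (∀ X → IsVertexCut H X → m ≤ ∣ X ∣))
  ⊎ ((¬ ∃ λ X → IsVertexCut H X) × m ≡ ∣ V H ∣ ∸ 1)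

_≟ˢ_ : DecidableEquality (Subset N)
_≟ˢ_ = ≡-dec _≟ᵇ_

_∈ᴸ?_ : (e : Subset N) (es : List (Subset N)) → Dec (e ∈ᴸ es)
_∈ᴸ?_ = DecMembership._∈?_ _≟ˢ_

-- Existence of a bounded-length list over a finite alphabet is decidable.
anyList? : {A : Set} (as : List A) (b : ℕ) {P : List A → Set} → Decidable P →
           Dec (∃ λ xs → All (_∈ᴸ as) xs × length xs ≤ b × P xs)
anyList? as b P? with P? []
... | yes p = yes ([] , [] , z≤n , p)
anyList? as zero    P? | no ¬p = no λ where ([] , _ , _ , p) → ¬p p
anyList? as (suc b) P? | no ¬p with any? (λ a → anyList? as b (P? ∘ (a ∷_))) as
... | yes q = let (a , a∈ , xs , xs∈ , len , p) = find q
              in  yes (a ∷ xs , a∈ ∷ xs∈ , s≤s len , p)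
... | no ¬q = no λ where
  ([] , _ , _ , p)                        → ¬p p
  (a ∷ xs , a∈ ∷ xs∈ , s≤s len , p)       → ¬q (lose a∈ (xs , xs∈ , len , p))

walk? : (H : Hypergraph N) → ∀ u v vs es → Dec (Walk H u v vs es)
walk? H u v []           es = no λ ()
walk? H u v (a ∷ [])     [] =
  map′ (λ where (refl , refl , p) → stop p) (λ where (stop p) → refl , refl , p)
       ((u ≟ᶠ a) ×-dec (u ≟ᶠ v) ×-dec (u ∈? V H))
walk? H u v (a ∷ b ∷ vs) [] = no λ ()
walk? H u v (a ∷ [])     (e ∷ es) = no λ where (step _ _ _ ())
walk? H u v (a ∷ b ∷ vs) (e ∷ es) =
  map′ (λ where (refl , p , q , s , w) → step p q s w)
       (λ where (step p q s w@(stop _))       → refl , p , q , s , w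
                (step p q s w@(step _ _ _ _)) → refl , p , q , s , w)
       ((u ≟ᶠ a) ×-dec (e ∈ᴸ? E H) ×-dec (u ∈? e) ×-dec (b ∈? e) ×-dec walk? H b v (b ∷ vs) es)

walk-edges : ∀ {H : Hypergraph N} {u v vs es} → Walk H u v vs es →
             All (_∈ᴸ E H) es × length es ≤ length vs
walk-edges (stop _)       = [] , z≤n
walk-edges (step p _ _ w) = let (ps , len) = walk-edges w in p ∷ ps , s≤s len

lookup-injective : {vs : List (Fin N)} → Unique vs → ∀ i j → lookup vs i ≡ lookup vs j → i ≡ j
lookup-injective (_ ∷ _)  zero    zero    _  = refl
lookup-injective (px ∷ _) zero    (suc j) eq = contradiction eq (All.lookup px (∈-lookup j))
lookup-injective (px ∷ _) (suc i) zero    eq = contradiction (sym eq) (All.lookup px (∈-lookup i))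
lookup-injective (_ ∷ u)  (suc i) (suc j) eq = cong suc (lookup-injective u i j eq)

unique-length : {vs : List (Fin N)} → Unique vs → length vs ≤ N
unique-length {vs = vs} u = injective⇒≤ (λ {i} {j} → lookup-injective u i j)

path? : (H : Hypergraph N) → ∀ u v → Dec (Path H u v)
path? {N} H u v = map′
  (λ (vs , _ , _ , es , _ , _ , p) → vs , es , p)
  (λ (vs , es , w , uvs , ues) →
     let (es∈ , len) = walk-edges w ; lvs = unique-length uvs in
     vs , All.tabulate (λ _ → ∈-allFin _) , lvs ,
     es , es∈ , ℕ.≤-trans len lvs , w , uvs , ues)
  (anyList? (allFin N) N λ vs → anyList? (E H) N λ es →
     walk? H u v vs es ×-dec DecUnique.unique? _≟ᶠ_ vs ×-dec DecUnique.unique? _≟ˢ_ es)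

connected? : (H : Hypergraph N) → Dec (Connected H)
connected? H = all? λ u → all? λ v → (u ∈? V H) →-dec (v ∈? V H) →-dec path? H u v

isVertexCut? : (H : Hypergraph N) → Decidable (IsVertexCut H)
isVertexCut? H X = (X ⊆? V H) ×-dec ¬? (connected? (H -ᵛ X))

smallest : {P : Subset N → Set} → Decidable P → ∀ b X → P X → ∣ X ∣ ≤ b →
           ∃ λ Y → P Y × (∀ Z → P Z → ∣ Y ∣ ≤ ∣ Z ∣)
smallest P? zero X p len = X , p , λ Z _ → ℕ.≤-trans len z≤n
smallest P? (suc b) X p len with anySubset? (λ Y → P? Y ×-dec (∣ Y ∣ ℕ.≤? b))
... | yes (Y , q , len′) = smallest P? b Y q len′
... | no ¬q = X , p , λ Z pZ → ℕ.≤-trans len (ℕ.≰⇒> λ le → ¬q (Z , pZ , le))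

opaque
  κ-exists : (H : Hypergraph N) → ∃ (IsConnectivity H)
  κ-exists {N} H with anySubset? (isVertexCut? H)
  ... | no none      = ∣ V H ∣ ∸ 1 , inj₂ (none , refl)
  ... | yes (X , cut) with smallest (isVertexCut? H) N X cut (∣p∣≤n X)
  ...   | Y , cutY , min = ∣ Y ∣ , inj₁ ((Y , cutY , refl) , min)

κ-unique : (H : Hypergraph N) → ∀ {m m′} → IsConnectivity H m → IsConnectivity H m′ → m ≡ m′
κ-unique H (inj₁ ((X , c , refl) , min)) (inj₁ ((X′ , c′ , refl) , min′)) =
  ℕ.≤-antisym (min X′ c′) (min′ X c)
κ-unique H (inj₁ ((X , c , _) , _)) (inj₂ (none , _))             = contradiction (X , c) none
κ-unique H (inj₂ (none , _))        (inj₁ ((X , c , _) , _))      = contradiction (X , c) none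
κ-unique H (inj₂ (_ , refl))        (inj₂ (_ , refl))             = refl

κ : Hypergraph N → ℕ
κ H = proj₁ (κ-exists H)

κ-spec : (H : Hypergraph N) → IsConnectivity H (κ H)
κ-spec H = proj₂ (κ-exists H)

-- κ̄(H) is the number m with this property; existence and uniqueness are shown
-- below.  The vertexless H′ ⊑ H has κ H′ ≡ 0 and so does not affect the maximum.
IsMaxConnectivity : Hypergraph N → ℕ → Set
IsMaxConnectivity H m = (∃ λ H′ → H′ ⊑ H × κ H′ ≡ m) × (∀ H′ → H′ ⊑ H → κ H′ ≤ m)

walk-mono : ∀ {H K : Hypergraph N} → H ⊑ K → ∀ {u v vs es} → Walk H u v vs es → Walk K u v vs es
walk-mono (V⊆ , E⊆) (stop p)       = stop (V⊆ p)
walk-mono (V⊆ , E⊆) (step p q s w) = step (E⊆ p) q s (walk-mono (V⊆ , E⊆) w)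

connected-resp : ∀ {H K : Hypergraph N} → H ⊑ K → K ⊑ H → Connected H → Connected K
connected-resp H⊑K K⊑H c u v u∈ v∈ =
  let (vs , es , w , p) = c u v (proj₁ K⊑H u∈) (proj₁ K⊑H v∈)
  in  vs , es , walk-mono H⊑K w , p

deletion-resp : ∀ {H K : Hypergraph N} X → V H ≡ V K → E H ⊆ᴸ E K → (H -ᵛ X) ⊑ (K -ᵛ X)
deletion-resp {H = H} {K} X refl E⊆ = (λ p → p) , λ p →
  let (q , s) = ∈-filter⁻ (_⊆? (V K ─ X)) {xs = E H} p
  in  ∈-filter⁺ (_⊆? (V K ─ X)) (E⊆ q) s

cut-resp : ∀ {H K : Hypergraph N} → H ⊑ K → K ⊑ H → ∀ {X} → IsVertexCut H X → IsVertexCut K X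
cut-resp {H = H} {K} (V⊆ , E⊆) (V⊇ , E⊇) {X} (X⊆ , ¬c) =
  ⊆-trans X⊆ V⊆ , ¬c ∘ connected-resp (deletion-resp {H = K} {H} X (sym V≡) E⊇)
                                        (deletion-resp {H = H} {K} X V≡ E⊆)
  where
  V≡ : V H ≡ V K
  V≡ = ⊆-antisym V⊆ V⊇

κ-resp : ∀ {H K : Hypergraph N} → H ⊑ K → K ⊑ H → κ H ≡ κ K
κ-resp {H = H} {K} H⊑K K⊑H = κ-unique K (transport (κ-spec H)) (κ-spec K)
  where
  transport : ∀ {m} → IsConnectivity H m → IsConnectivity K m
  transport (inj₁ ((X , c , eq) , min)) =
    inj₁ ((X , cut-resp {H = H} {K} H⊑K K⊑H c , eq) ,
          λ Y → min Y ∘ cut-resp {H = K} {H} K⊑H H⊑K)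
  transport (inj₂ (none , eq)) =
    inj₂ ((λ (X , c) → none (X , cut-resp {H = K} {H} K⊑H H⊑K c)) ,
          trans eq (cong (λ p → ∣ p ∣ ∸ 1) (⊆-antisym (proj₁ H⊑K) (proj₁ K⊑H))))

kept? : (H : Hypergraph N) (W : Subset N) (F : List (Subset N)) →
        Decidable (λ e → e ∈ᴸ F × e ⊆ W ∩ V H)
kept? H W F e = (e ∈ᴸ? F) ×-dec (e ⊆? (W ∩ V H))

-- A cut-down of H to the vertices in W and the edges in F; every
-- subhypergraph of H is of this form up to the order of its edges.
restrict : Hypergraph N → Subset N → List (Subset N) → Hypergraph N
restrict H W F = record
  { V          = W ∩ V H
  ; E          = filter keep? (E H)
  ; E-unique   = Unique.filter⁺ keep? (E-unique H)
  ; E-nonempty = filter⁺ keep? (E-nonempty H)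
  ; E-within   = All.map proj₂ (all-filter keep? (E H))
  }
  where
  keep? = kept? H W F

restrict-⊑ : (H : Hypergraph N) → ∀ W F → restrict H W F ⊑ H
restrict-⊑ H W F = p∩q⊆q W (V H) , proj₁ ∘ ∈-filter⁻ (kept? H W F) {xs = E H}

κ-restrict : (H H′ : Hypergraph N) → H′ ⊑ H →
             κ H′ ≡ κ (restrict H (V H′) (filter (_∈ᴸ? E H′) (E H)))
κ-restrict H H′ (V⊆ , E⊆) = κ-resp {H = H′} {K} (to , to-E) (p∩q⊆p _ _ , from-E)
  where
  W = V H′
  F = filter (_∈ᴸ? E H′) (E H)
  K = restrict H W F
  to : V H′ ⊆ V K
  to p = x∈p∩q⁺ (p , V⊆ p)
  within : ∀ {e} → e ∈ᴸ E H′ → e ⊆ V K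
  within p x∈e = to (All.lookup (E-within H′) p x∈e)
  to-E : E H′ ⊆ᴸ E K
  to-E p = ∈-filter⁺ (kept? H W F) (E⊆ p)
    (∈-filter⁺ (_∈ᴸ? E H′) (E⊆ p) p , within p)
  from-E : E K ⊆ᴸ E H′
  from-E p = proj₂ (∈-filter⁻ (_∈ᴸ? E H′) {xs = E H} (proj₁ (proj₂ (∈-filter⁻ (kept? H W F) {xs = E H} p))))

argmaxSubset : ∀ {n} (f : Subset n → ℕ) → ∃ λ S → ∀ S′ → f S′ ≤ f S
argmaxSubset {zero}  f = []ᵛ , λ where []ᵛ → ℕ.≤-refl
argmaxSubset {suc n} f with argmaxSubset (f ∘ (inside ∷ᵛ_)) | argmaxSubset (f ∘ (outside ∷ᵛ_))
... | S , p | T , q with ℕ.≤-total (f (inside ∷ᵛ S)) (f (outside ∷ᵛ T))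
...   | inj₁ le = outside ∷ᵛ T , λ where
  (inside  ∷ᵛ S′) → ℕ.≤-trans (p S′) le
  (outside ∷ᵛ S′) → q S′
...   | inj₂ ge = inside ∷ᵛ S , λ where
  (inside  ∷ᵛ S′) → p S′
  (outside ∷ᵛ S′) → ℕ.≤-trans (q S′) ge

argmaxFilter : {A : Set} (xs : List A) (f : List A → ℕ) →
               ∃ λ ys → ∀ {P : A → Set} (P? : Decidable P) → f (filter P? xs) ≤ f ys
argmaxFilter []       f = [] , λ _ → ℕ.≤-refl
argmaxFilter (x ∷ xs) f with argmaxFilter xs (f ∘ (x ∷_)) | argmaxFilter xs f
... | ys , p | zs , q with ℕ.≤-total (f (x ∷ ys)) (f zs)
...   | inj₁ le = zs , bound
  where
  bound : ∀ {P : _ → Set} (P? : Decidable P) → f (filter P? (x ∷ xs)) ≤ f zs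
  bound P? with P? x
  ... | yes px rewrite filter-accept P? {xs = xs} px = ℕ.≤-trans (p P?) le
  ... | no ¬px rewrite filter-reject P? {xs = xs} ¬px = q P?
...   | inj₂ ge = x ∷ ys , bound
  where
  bound : ∀ {P : _ → Set} (P? : Decidable P) → f (filter P? (x ∷ xs)) ≤ f (x ∷ ys)
  bound P? with P? x
  ... | yes px rewrite filter-accept P? {xs = xs} px = p P?
  ... | no ¬px rewrite filter-reject P? {xs = xs} ¬px = ℕ.≤-trans (q P?) ge

argmaxPair : ∀ {n} {A : Set} (xs : List A) (f : Subset n → List A → ℕ) →
             ∃₂ λ S ys → ∀ S′ {P : A → Set} (P? : Decidable P) → f S′ (filter P? xs) ≤ f S ys
argmaxPair xs f =
  let g        = λ S → argmaxFilter xs (f S)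
      (S , le) = argmaxSubset (λ S → f S (proj₁ (g S)))
  in  S , proj₁ (g S) , λ S′ P? → ℕ.≤-trans (proj₂ (g S′) P?) (le S′)

opaque
  κ̄-exists : (H : Hypergraph N) → ∃ (IsMaxConnectivity H)
  κ̄-exists H with argmaxPair (E H) (λ W F → κ (restrict H W F))
  ... | W , F , max =
    κ (restrict H W F) , (restrict H W F , restrict-⊑ H W F , refl) , λ H′ H′⊑H →
      ℕ.≤-trans (ℕ.≤-reflexive (κ-restrict H H′ H′⊑H)) (max (V H′) (_∈ᴸ? E H′))

κ̄-unique : (H : Hypergraph N) → ∀ {m m′} → IsMaxConnectivity H m → IsMaxConnectivity H m′ → m ≡ m′
κ̄-unique H ((K , K⊑ , refl) , max) ((K′ , K′⊑ , refl) , max′) =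
  ℕ.≤-antisym (max′ K K⊑) (max K′ K′⊑)

κ̄ : Hypergraph N → ℕ
κ̄ H = proj₁ (κ̄-exists H)

κ̄-spec : (H : Hypergraph N) → IsMaxConnectivity H (κ̄ H)
κ̄-spec H = proj₂ (κ̄-exists H)

record VertexMaximal (k r : ℕ) (H : Hypergraph N) : Set where
  field
    uniform : Uniform r H
    bounded : κ̄ H ≤ k
    maximal : ∀ e (c : ComplementEdge r H e) → κ̄ (addEdge H e c) ≥ suc k

{-# OPTIONS --safe #-}
module Submission where

-- Call a non-edge e of H critical if H + e has a subhypergraph K with κ(K) > k.
-- If κ̄(H) ≤ k then H has at most C(n∸k, r) critical non-edges; when H is
-- vertex-k-maximal every non-edge is critical, which is the theorem.
--
-- The bound goes by induction on n.  If n ≤ k + 1, then κ(K) ≤ n − 1 ≤ k and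
-- there are no critical non-edges.  Otherwise H has a vertex-cut of size ≤ k,
-- which moving vertices from the sides enlarges to one of size exactly k, with
-- sides A and B.  Fewer than κ(K) vertices of K lie outside A ∪ B, so unless e
-- is an r-set within A ∪ B meeting both sides, K misses A or B, and then e is
-- critical in H − A or in H − B, which have k + |B| and k + |A| vertices.  By
-- induction at most C(|B|, r) + C(|A|, r) such e are of the latter kind, as many
-- as there are r-sets within one side; all together number at most C(|A|+|B|, r).

open import Defs
open import Data.Nat using (ℕ; _+_; _∸_; _≤_; _≥_)
open import Data.Nat.Combinatorics using (_C_)
open import Data.Fin.Subset using (∣_∣)
open import Data.List using (length)
open import Relation.Binary.PropositionalEquality using (_≡_)

open import Data.Empty using (⊥-elim)
open import Data.Fin using (Fin; zero; suc)
open import Data.Fin.Properties using (¬∀⟶∃¬; all?) renaming (any? to anyᶠ?; _≟_ to _≟ᶠ_)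
open import Data.Fin.Subset using (Subset; inside; outside; ⊥; _∈_; _∉_; _⊆_; _∪_; _─_; Nonempty)
open import Data.Fin.Subset.Properties
  using (_∈?_; _⊆?_; nonempty?; ⊆-trans; ⊥⊆; ∣⊥∣≡0; p⊆q⇒∣p∣≤∣q∣; p⊆p∪q; q⊆p∪q;
         x∈p∪q⁻; x∈p∪q⁺; p─q⊆p; x∈p∧x∉q⇒x∈p─q; drop-∷-⊆; drop-there; out⊆; s⊆s)
open import Data.List using (List; []; _∷_; _++_; map; filter)
open import Data.List.Properties using (length-++; length-map)
open import Data.List.Membership.Propositional using () renaming (_∈_ to _∈ᴸ_)
open import Data.List.Membership.Propositional.Properties
  using (∈-++⁺ˡ; ∈-++⁺ʳ; ∈-++⁻; ∈-map⁺; ∈-map⁻; ∈-filter⁺; ∈-filter⁻; ∈-∃++)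
open import Data.List.Relation.Binary.Disjoint.Propositional using (Disjoint)
open import Data.List.Relation.Binary.Subset.Propositional using () renaming (_⊆_ to _⊆ᴸ_)
open import Data.List.Relation.Unary.All as All using (All; []; _∷_)
open import Data.List.Relation.Unary.All.Properties using (¬Any⇒All¬)
open import Data.List.Relation.Unary.AllPairs using ([]; _∷_)
open import Data.List.Relation.Unary.Any using (here; there)
open import Data.List.Relation.Unary.Unique.Propositional using (Unique)
import Data.List.Relation.Unary.Unique.Propositional.Properties as Unique
import Data.List.Membership.DecPropositional as DecMembership
open import Data.Nat using (zero; suc; _<_; z≤n; s≤s; s≤s⁻¹; _≤?_)
open import Data.Nat.Combinatorics using (nCk≡nC[n∸k]; nCn≡1; nCk+nC[k+1]≡[n+1]C[k+1])
open import Data.Nat.Properties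
open import Data.Product using (∃; ∃₂; _×_; _,_; proj₁; proj₂)
open import Data.Sum using (_⊎_; inj₁; inj₂; [_,_]; swap)
open import Data.Vec using (here; there) renaming ([] to []ᵛ; _∷_ to _∷ᵛ_)
open import Data.Vec.Properties using (∷-injectiveʳ)
open import Function using (_∘_; id; case_of_)
open import Relation.Binary.PropositionalEquality using (refl; sym; trans; cong; cong₂; subst)
open import Relation.Nullary using (¬_; Dec; yes; no; contradiction)
open import Relation.Nullary.Decidable using (_×-dec_; _→-dec_; ¬?; decidable-stable)

private
  variable
    N k r : ℕ
    X : Set
    A B e p q : Subset N
    H K : Hypergraph N
    u v w : Fin N
    vs : List (Fin N)
    es : List (Subset N)

-- Repetition-free lists as finite sets

unique-⊆⇒length≤ : {xs ys : List X} → Unique xs → xs ⊆ᴸ ys → length xs ≤ length ys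
unique-⊆⇒length≤ []       _  = z≤n
unique-⊆⇒length≤ {xs = x ∷ xs} (x∉ ∷ u) xs⊆ with ∈-∃++ (xs⊆ (here refl))
... | as , bs , refl = begin
  suc (length xs)              ≤⟨ s≤s (unique-⊆⇒length≤ u rest⊆) ⟩
  suc (length (as ++ bs))      ≡⟨ cong suc (length-++ as) ⟩
  suc (length as + length bs)  ≡⟨ sym (+-suc (length as) (length bs)) ⟩
  length as + suc (length bs)  ≡⟨ sym (length-++ as) ⟩
  length (as ++ x ∷ bs)        ∎
  where
  open ≤-Reasoning
  rest⊆ : xs ⊆ᴸ as ++ bs
  rest⊆ z∈ with ∈-++⁻ as (xs⊆ (there z∈))
  ... | inj₁ z∈as         = ∈-++⁺ˡ z∈as
  ... | inj₂ (here refl)  = contradiction refl (All.lookup x∉ z∈)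
  ... | inj₂ (there z∈bs) = ∈-++⁺ʳ as z∈bs

-- The predicates need not be decidable: each element goes to the list of whichever disjunct its
-- proof supplies, where `filter` would ask for a decision.
unique-split : {P Q : X → Set} {xs : List X} → Unique xs → All (λ x → P x ⊎ Q x) xs →
               ∃₂ λ ys zs → (Unique ys × All P ys × ys ⊆ᴸ xs) ×
                            (Unique zs × All Q zs × zs ⊆ᴸ xs) ×
                            length xs ≡ length ys + length zs
unique-split [] [] = [] , [] , ([] , [] , id) , ([] , [] , id) , refl
unique-split {xs = x ∷ _} (x∉ ∷ u) (pq ∷ pqs) with unique-split u pqs
... | ys , zs , (uy , ps , ys⊆) , (uz , qs , zs⊆) , eq with pq
...   | inj₁ p = x ∷ ys , zs ,
  (All.tabulate (λ y∈ → All.lookup x∉ (ys⊆ y∈)) ∷ uy , p ∷ ps ,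
   λ where (here refl) → here refl ; (there y∈) → there (ys⊆ y∈)) ,
  (uz , qs , there ∘ zs⊆) , cong suc eq
...   | inj₂ q = ys , x ∷ zs ,
  (uy , ps , there ∘ ys⊆) ,
  (All.tabulate (λ z∈ → All.lookup x∉ (zs⊆ z∈)) ∷ uz , q ∷ qs ,
   λ where (here refl) → here refl ; (there z∈) → there (zs⊆ z∈)) ,
  trans (cong suc eq) (sym (+-suc (length ys) (length zs)))

-- Differences, unions and sizes of subsets

x∈p─q⇒x∉q : ∀ (p q : Subset N) → v ∈ p ─ q → v ∉ q
x∈p─q⇒x∉q (_ ∷ᵛ p) (outside ∷ᵛ q) (there v∈) (there v∈q) = x∈p─q⇒x∉q p q v∈ v∈q
x∈p─q⇒x∉q (_ ∷ᵛ p) (inside ∷ᵛ q)  (there v∈) (there v∈q) = x∈p─q⇒x∉q p q v∈ v∈q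

∣p─q∣+∣q∣≡∣p∣ : ∀ (p q : Subset N) → q ⊆ p → ∣ p ─ q ∣ + ∣ q ∣ ≡ ∣ p ∣
∣p─q∣+∣q∣≡∣p∣ []ᵛ []ᵛ _ = refl
∣p─q∣+∣q∣≡∣p∣ (outside ∷ᵛ p) (outside ∷ᵛ q) q⊆p = ∣p─q∣+∣q∣≡∣p∣ p q (drop-∷-⊆ q⊆p)
∣p─q∣+∣q∣≡∣p∣ (inside ∷ᵛ p)  (outside ∷ᵛ q) q⊆p = cong suc (∣p─q∣+∣q∣≡∣p∣ p q (drop-∷-⊆ q⊆p))
∣p─q∣+∣q∣≡∣p∣ (inside ∷ᵛ p)  (inside ∷ᵛ q)  q⊆p =
  trans (+-suc ∣ p ─ q ∣ ∣ q ∣) (cong suc (∣p─q∣+∣q∣≡∣p∣ p q (drop-∷-⊆ q⊆p)))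
∣p─q∣+∣q∣≡∣p∣ (outside ∷ᵛ p) (inside ∷ᵛ q)  q⊆p = case q⊆p here of λ ()

∣p∪q∣≡∣p∣+∣q∣ : ∀ (p q : Subset N) → (∀ {x} → x ∈ p → x ∉ q) → ∣ p ∪ q ∣ ≡ ∣ p ∣ + ∣ q ∣
∣p∪q∣≡∣p∣+∣q∣ []ᵛ []ᵛ _ = refl
∣p∪q∣≡∣p∣+∣q∣ (outside ∷ᵛ p) (outside ∷ᵛ q) d = ∣p∪q∣≡∣p∣+∣q∣ p q (λ x∈p x∈q → d (there x∈p) (there x∈q))
∣p∪q∣≡∣p∣+∣q∣ (inside ∷ᵛ p)  (outside ∷ᵛ q) d =
  cong suc (∣p∪q∣≡∣p∣+∣q∣ p q (λ x∈p x∈q → d (there x∈p) (there x∈q)))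
∣p∪q∣≡∣p∣+∣q∣ (outside ∷ᵛ p) (inside ∷ᵛ q)  d =
  trans (cong suc (∣p∪q∣≡∣p∣+∣q∣ p q (λ x∈p x∈q → d (there x∈p) (there x∈q)))) (sym (+-suc ∣ p ∣ ∣ q ∣))
∣p∪q∣≡∣p∣+∣q∣ (inside ∷ᵛ p)  (inside ∷ᵛ q)  d = contradiction here (d here)

p∪q⊆ : ∀ {s : Subset N} → p ⊆ s → q ⊆ s → p ∪ q ⊆ s
p∪q⊆ {p = p} {q} p⊆ q⊆ x∈ = [ p⊆ , q⊆ ] (x∈p∪q⁻ p q x∈)

∪-mono : ∀ {p′ q′ : Subset N} → p ⊆ p′ → q ⊆ q′ → p ∪ q ⊆ p′ ∪ q′
∪-mono {p′ = p′} {q′} p⊆ q⊆ = p∪q⊆ (⊆-trans p⊆ (p⊆p∪q q′)) (⊆-trans q⊆ (q⊆p∪q p′ q′))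

nonempty⇒1≤∣p∣ : ∀ {p : Subset N} → Nonempty p → 1 ≤ ∣ p ∣
nonempty⇒1≤∣p∣ {p = inside ∷ᵛ p}  _                 = s≤s z≤n
nonempty⇒1≤∣p∣ {p = outside ∷ᵛ p} (_ , there x∈p) = nonempty⇒1≤∣p∣ (_ , x∈p)

1≤∣p∣⇒nonempty : ∀ {p : Subset N} → 1 ≤ ∣ p ∣ → Nonempty p
1≤∣p∣⇒nonempty {p = inside ∷ᵛ p}  _  = _ , here
1≤∣p∣⇒nonempty {p = outside ∷ᵛ p} le = let (_ , x∈p) = 1≤∣p∣⇒nonempty {p = p} le in _ , there x∈p

subsetOfSize : ∀ (p : Subset N) {m} → m ≤ ∣ p ∣ → ∃ λ q → q ⊆ p × ∣ q ∣ ≡ m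
subsetOfSize []ᵛ z≤n = []ᵛ , id , refl
subsetOfSize (outside ∷ᵛ p) le =
  let (q , q⊆ , eq) = subsetOfSize p le in outside ∷ᵛ q , s⊆s q⊆ , eq
subsetOfSize {N} (inside ∷ᵛ p) {zero} le = ⊥ , ⊥⊆ , ∣⊥∣≡0 N
subsetOfSize (inside ∷ᵛ p) {suc m} (s≤s le) =
  let (q , q⊆ , eq) = subsetOfSize p le in inside ∷ᵛ q , s⊆s q⊆ , cong suc eq

-- The `r`-element subsets of a set

subsets : ℕ → Subset N → List (Subset N)
subsets zero    p              = ⊥ ∷ []
subsets (suc r) []ᵛ            = []
subsets (suc r) (outside ∷ᵛ p) = map (outside ∷ᵛ_) (subsets (suc r) p)
subsets (suc r) (inside ∷ᵛ p)  = map (inside ∷ᵛ_) (subsets r p) ++ map (outside ∷ᵛ_) (subsets (suc r) p)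

nC0≡1 : ∀ n → n C 0 ≡ 1
nC0≡1 n = trans (nCk≡nC[n∸k] {n = n} z≤n) (nCn≡1 n)

-- The clauses of `subsets` follow Pascal's rule.
length-subsets : ∀ r (p : Subset N) → length (subsets r p) ≡ ∣ p ∣ C r
length-subsets zero    p              = sym (nC0≡1 ∣ p ∣)
length-subsets (suc r) []ᵛ            = refl
length-subsets (suc r) (outside ∷ᵛ p) = trans (length-map _ (subsets (suc r) p)) (length-subsets (suc r) p)
length-subsets (suc r) (inside ∷ᵛ p)  =
  trans (length-++ (map (inside ∷ᵛ_) (subsets r p)))
  (trans (cong₂ _+_ (trans (length-map _ (subsets r p)) (length-subsets r p))
                    (trans (length-map _ (subsets (suc r) p)) (length-subsets (suc r) p)))
         (nCk+nC[k+1]≡[n+1]C[k+1] ∣ p ∣ r))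

subsets-unique : ∀ r (p : Subset N) → Unique (subsets r p)
subsets-unique zero    p              = [] ∷ []
subsets-unique (suc r) []ᵛ            = []
subsets-unique (suc r) (outside ∷ᵛ p) = Unique.map⁺ ∷-injectiveʳ (subsets-unique (suc r) p)
subsets-unique (suc r) (inside ∷ᵛ p)  =
  Unique.++⁺ (Unique.map⁺ ∷-injectiveʳ (subsets-unique r p))
             (Unique.map⁺ ∷-injectiveʳ (subsets-unique (suc r) p))
             λ (s∈ , t∈) → case (∈-map⁻ _ s∈ , ∈-map⁻ _ t∈) of λ where
               ((_ , _ , refl) , (_ , _ , ()))

∈-subsets⁻ : ∀ r (p : Subset N) → e ∈ᴸ subsets r p → e ⊆ p × ∣ e ∣ ≡ r
∈-subsets⁻ {N} zero p (here refl) = ⊥⊆ , ∣⊥∣≡0 N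
∈-subsets⁻ (suc r) (outside ∷ᵛ p) e∈ with ∈-map⁻ _ e∈
... | _ , e∈′ , refl = let (e⊆ , eq) = ∈-subsets⁻ (suc r) p e∈′ in s⊆s e⊆ , eq
∈-subsets⁻ (suc r) (inside ∷ᵛ p) e∈ with ∈-++⁻ (map (inside ∷ᵛ_) (subsets r p)) e∈
... | inj₁ e∈₁ with ∈-map⁻ _ e∈₁
...   | _ , e∈′ , refl = let (e⊆ , eq) = ∈-subsets⁻ r p e∈′ in s⊆s e⊆ , cong suc eq
∈-subsets⁻ (suc r) (inside ∷ᵛ p) e∈ | inj₂ e∈₂ with ∈-map⁻ _ e∈₂
...   | _ , e∈′ , refl = let (e⊆ , eq) = ∈-subsets⁻ (suc r) p e∈′ in out⊆ e⊆ , eq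

∣p∣≡0⇒p≡⊥ : ∀ (p : Subset N) → ∣ p ∣ ≡ 0 → p ≡ ⊥
∣p∣≡0⇒p≡⊥ []ᵛ            _  = refl
∣p∣≡0⇒p≡⊥ (outside ∷ᵛ p) eq = cong (outside ∷ᵛ_) (∣p∣≡0⇒p≡⊥ p eq)

∈-subsets⁺ : ∀ r (p : Subset N) → e ⊆ p → ∣ e ∣ ≡ r → e ∈ᴸ subsets r p
∈-subsets⁺ {e = e} zero p e⊆ eq = here (∣p∣≡0⇒p≡⊥ e eq)
∈-subsets⁺ {e = outside ∷ᵛ e} (suc r) (outside ∷ᵛ p) e⊆ eq =
  ∈-map⁺ _ (∈-subsets⁺ (suc r) p (drop-∷-⊆ e⊆) eq)
∈-subsets⁺ {e = inside ∷ᵛ e}  (suc r) (outside ∷ᵛ p) e⊆ eq = case e⊆ here of λ ()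
∈-subsets⁺ {e = inside ∷ᵛ e}  (suc r) (inside ∷ᵛ p)  e⊆ eq =
  ∈-++⁺ˡ (∈-map⁺ _ (∈-subsets⁺ r p (drop-∷-⊆ e⊆) (suc-injective eq)))
∈-subsets⁺ {e = outside ∷ᵛ e} (suc r) (inside ∷ᵛ p)  e⊆ eq =
  ∈-++⁺ʳ (map (inside ∷ᵛ_) (subsets r p)) (∈-map⁺ _ (∈-subsets⁺ (suc r) p (drop-∷-⊆ e⊆) eq))

-- Sets meeting both of two disjoint sides

Crossing : Subset N → Subset N → Subset N → Set
Crossing A B e = e ⊆ A ∪ B × ¬ e ⊆ A × ¬ e ⊆ B

crossing? : ∀ (A B e : Subset N) → Dec (Crossing A B e)
crossing? A B e = (e ⊆? A ∪ B) ×-dec ¬? (e ⊆? A) ×-dec ¬? (e ⊆? B)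

-- The members of `L`, the `r`-sets within `A` and those within `B` are three disjoint families of
-- `r`-subsets of `A ∪ B`. The bound `1 ≤ r` excludes the empty set, which would lie within both
-- sides.
crossing-count : ∀ {L : List (Subset N)} → (∀ {x} → x ∈ A → x ∉ B) → 1 ≤ r →
                 Unique L → All (λ e → Crossing A B e × ∣ e ∣ ≡ r) L →
                 length L + (∣ A ∣ C r + ∣ B ∣ C r) ≤ (∣ A ∣ + ∣ B ∣) C r
crossing-count {A = A} {B} {r} {L} disjoint 1≤r uL cross = begin
  length L + (∣ A ∣ C r + ∣ B ∣ C r)
    ≡⟨ cong (length L +_) (cong₂ _+_ (sym (length-subsets r A)) (sym (length-subsets r B))) ⟩
  length L + (length SA + length SB)   ≡⟨ cong (length L +_) (sym (length-++ SA)) ⟩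
  length L + length (SA ++ SB)         ≡⟨ sym (length-++ L) ⟩
  length (L ++ SA ++ SB)               ≤⟨ unique-⊆⇒length≤ unique all⊆ ⟩
  length (subsets r (A ∪ B))           ≡⟨ length-subsets r (A ∪ B) ⟩
  ∣ A ∪ B ∣ C r                        ≡⟨ cong (_C r) (∣p∪q∣≡∣p∣+∣q∣ A B disjoint) ⟩
  (∣ A ∣ + ∣ B ∣) C r                  ∎
  where
  open ≤-Reasoning
  SA = subsets r A
  SB = subsets r B
  disjAB : Disjoint SA SB
  disjAB (a∈ , b∈) =
    let (e⊆A , eq) = ∈-subsets⁻ r A a∈
        (e⊆B , _)  = ∈-subsets⁻ r B b∈
        (_ , x∈e)  = 1≤∣p∣⇒nonempty (subst (1 ≤_) (sym eq) 1≤r)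
    in  disjoint (e⊆A x∈e) (e⊆B x∈e)
  disjL : Disjoint L (SA ++ SB)
  disjL (l∈ , s∈) =
    let ((_ , ⊈A , ⊈B) , _) = All.lookup cross l∈ in
    [ ⊈A ∘ proj₁ ∘ ∈-subsets⁻ r A , ⊈B ∘ proj₁ ∘ ∈-subsets⁻ r B ] (∈-++⁻ SA s∈)
  unique : Unique (L ++ SA ++ SB)
  unique = Unique.++⁺ uL (Unique.++⁺ (subsets-unique r A) (subsets-unique r B) disjAB) disjL
  all⊆ : L ++ SA ++ SB ⊆ᴸ subsets r (A ∪ B)
  all⊆ e∈ with ∈-++⁻ L e∈
  ... | inj₁ l∈ = let ((e⊆ , _) , eq) = All.lookup cross l∈ in ∈-subsets⁺ r (A ∪ B) e⊆ eq
  ... | inj₂ s∈ with ∈-++⁻ SA s∈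
  ...   | inj₁ a∈ = let (e⊆ , eq) = ∈-subsets⁻ r A a∈ in ∈-subsets⁺ r (A ∪ B) (⊆-trans e⊆ (p⊆p∪q B)) eq
  ...   | inj₂ b∈ = let (e⊆ , eq) = ∈-subsets⁻ r B b∈ in ∈-subsets⁺ r (A ∪ B) (⊆-trans e⊆ (q⊆p∪q A B)) eq

-- Prolonging a path at its start

path-suffix-vertex : Walk H u v vs es → Unique vs → Unique es → w ∈ᴸ vs → Path H w v
-- The walk is returned whole in both clauses; its constructor is matched to reveal that `vs` begins
-- with the starting vertex.
path-suffix-vertex W@(stop _)         uv       ue       (here refl) = _ , _ , W , uv , ue
path-suffix-vertex W@(step _ _ _ _)   uv       ue       (here refl) = _ , _ , W , uv , ue
path-suffix-vertex (step _ _ _ W)     (_ ∷ uv) (_ ∷ ue) (there w∈)  = path-suffix-vertex W uv ue w∈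

-- Where the path traverses `e`, the vertex before `e` is replaced by `w` and everything earlier is
-- dropped. Vertices stay distinct because `w` is not on the path.
path-suffix-edge : Walk H u v vs es → Unique vs → Unique es → ¬ w ∈ᴸ vs → w ∈ e → e ∈ᴸ es → Path H w v
path-suffix-edge (step e∈ _ y∈e W) (_ ∷ uv) ue w∉ w∈e (here refl) =
  _ , _ , step e∈ w∈e y∈e W , ¬Any⇒All¬ _ (w∉ ∘ there) ∷ uv , ue
path-suffix-edge (step _ _ _ W) (_ ∷ uv) (_ ∷ ue) w∉ w∈e (there e∈) =
  path-suffix-edge W uv ue (w∉ ∘ there) w∈e e∈

-- Prepending `w` and `e` may repeat a vertex or an edge. If `w` is already on the path, the suffix
-- from `w` serves; if only `e` is, the path is entered at `e`.
path-extend : e ∈ᴸ E H → w ∈ e → u ∈ e → Path H u v → Path H w v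
path-extend {e = e} {w = w} e∈ w∈e u∈e (vs , es , W , uv , ue)
  with DecMembership._∈?_ _≟ᶠ_ w vs | e ∈ᴸ? es
... | yes w∈ | _       = path-suffix-vertex W uv ue w∈
... | no w∉  | yes e∈′ = path-suffix-edge W uv ue w∉ w∈e e∈′
... | no w∉  | no e∉   = _ , _ , step e∈ w∈e u∈e W , ¬Any⇒All¬ vs w∉ ∷ uv , ¬Any⇒All¬ es e∉ ∷ ue

-- Vertex-cuts as separations

comprehension : ∀ {N} {P : Fin N → Set} → (∀ x → Dec (P x)) →
                ∃ λ (S : Subset N) → ∀ x → (P x → x ∈ S) × (x ∈ S → P x)
comprehension {zero}  P? = []ᵛ , λ ()
comprehension {suc N} P? with comprehension (P? ∘ suc) | P? zero
... | S , spec | yes p = inside ∷ᵛ S , λ where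
  zero    → (λ _ → here) , λ _ → p
  (suc x) → there ∘ proj₁ (spec x) , proj₂ (spec x) ∘ drop-there
... | S , spec | no ¬p = outside ∷ᵛ S , λ where
  zero    → (λ p → contradiction p ¬p) , λ ()
  (suc x) → there ∘ proj₁ (spec x) , proj₂ (spec x) ∘ drop-there

-- A vertex-cut X is represented by two sides A and B, with X = V ─ (A ∪ B).
-- No connectedness of the sides is required.
record Separation (H : Hypergraph N) (A B : Subset N) : Set where
  field
    A⊆V       : A ⊆ V H
    B⊆V       : B ⊆ V H
    A-ne      : Nonempty A
    B-ne      : Nonempty B
    disjoint  : ∀ {x} → x ∈ A → x ∉ B
    separates : ∀ {f} → f ∈ᴸ E H → f ⊆ A ∪ B → f ⊆ A ⊎ f ⊆ B

separation-swap : Separation H A B → Separation H B A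
separation-swap {A = A} {B} S = record
  { A⊆V       = B⊆V
  ; B⊆V       = A⊆V
  ; A-ne      = B-ne
  ; B-ne      = A-ne
  ; disjoint  = λ x∈B x∈A → disjoint x∈A x∈B
  ; separates = λ f∈ f⊆ → swap (separates f∈ (λ x∈f → x∈p∪q⁺ (swap (x∈p∪q⁻ B A (f⊆ x∈f)))))
  }
  where open Separation S

-- Witnesses can be extracted from the negation because `path?` decides each pair and `Fin N` is
-- finite.
disconnected⇒∃¬path : (H : Hypergraph N) → ¬ Connected H →
                      ∃₂ λ u v → u ∈ V H × v ∈ V H × ¬ Path H u v
disconnected⇒∃¬path {N} H ¬c =
  let inner? = λ u v → (u ∈? V H) →-dec (v ∈? V H) →-dec path? H u v
      (u , ¬∀v) = ¬∀⟶∃¬ N _ (λ u → all? (inner? u)) ¬c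
      (v , ¬uv) = ¬∀⟶∃¬ N _ (inner? u) ¬∀v
  in  u , v ,
      decidable-stable (u ∈? V H) (λ u∉ → ¬uv (λ u∈ → contradiction u∈ u∉)) ,
      decidable-stable (v ∈? V H) (λ v∉ → ¬uv (λ _ v∈ → contradiction v∈ v∉)) ,
      λ p → ¬uv (λ _ _ → p)

-- `A` is the component of `v` in `H -ᵛ X`, and `A′` is the rest, which contains `u`. An edge within
-- `W` that meets `A` lies in `A` by `path-extend`; one that does not meet `A` lies in `A′`.
cut⇒separation : ∀ {X} → IsVertexCut H X →
                 ∃₂ λ A B → Separation H A B × ∣ V H ∣ ≤ ∣ A ∣ + ∣ B ∣ + ∣ X ∣
cut⇒separation {H = H} {X} (X⊆V , ¬c)
  with disconnected⇒∃¬path (H -ᵛ X) ¬c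
... | u , v , u∈ , v∈ , ¬path
  with comprehension (λ w → (w ∈? V H ─ X) ×-dec path? (H -ᵛ X) w v)
... | A , spec = A , A′ , separation , size
  where
  W = V H ─ X
  A′ = W ─ A
  A⊆W : A ⊆ W
  A⊆W x∈A = proj₁ (proj₂ (spec _) x∈A)
  W⊆A∪A′ : W ⊆ A ∪ A′
  W⊆A∪A′ {x} x∈W with x ∈? A
  ... | yes x∈A = x∈p∪q⁺ (inj₁ x∈A)
  ... | no x∉A  = x∈p∪q⁺ (inj₂ (x∈p∧x∉q⇒x∈p─q x∈W x∉A))
  A∪A′⊆W : A ∪ A′ ⊆ W
  A∪A′⊆W = p∪q⊆ A⊆W (p─q⊆p W A)
  disj : ∀ {x} → x ∈ A → x ∉ A′
  disj x∈A x∈A′ = x∈p─q⇒x∉q W A x∈A′ x∈A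
  spread : ∀ {f x} → f ∈ᴸ E H → f ⊆ W → x ∈ f → x ∈ A → f ⊆ A
  spread f∈ f⊆W x∈f x∈A y∈f = proj₁ (spec _)
    (f⊆W y∈f , path-extend (∈-filter⁺ (_⊆? W) f∈ f⊆W) y∈f x∈f (proj₂ (proj₂ (spec _) x∈A)))
  sep : ∀ {f} → f ∈ᴸ E H → f ⊆ A ∪ A′ → f ⊆ A ⊎ f ⊆ A′
  sep {f} f∈ f⊆ with nonempty? (f ─ A′)
  ... | yes (x , x∈) = let x∈f = p─q⊆p f A′ x∈ in
    inj₁ (spread f∈ (⊆-trans f⊆ A∪A′⊆W) x∈f
      ([ id , (λ x∈A′ → contradiction x∈A′ (x∈p─q⇒x∉q f A′ x∈)) ] (x∈p∪q⁻ A A′ (f⊆ x∈f))))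
  ... | no empty = inj₂ λ {x} x∈f →
    decidable-stable (x ∈? A′) λ x∉ → empty (x , x∈p∧x∉q⇒x∈p─q x∈f x∉)
  separation : Separation H A A′
  separation = record
    { A⊆V = ⊆-trans A⊆W (p─q⊆p (V H) X)
    ; B⊆V = ⊆-trans (p─q⊆p W A) (p─q⊆p (V H) X)
    ; A-ne = v , proj₁ (spec v) (v∈ , v ∷ [] , [] , stop v∈ , [] ∷ [] , [])
    ; B-ne = u , x∈p∧x∉q⇒x∈p─q u∈ (λ u∈A → ¬path (proj₂ (proj₂ (spec u) u∈A)))
    ; disjoint = disj
    ; separates = sep
    }
  size : ∣ V H ∣ ≤ ∣ A ∣ + ∣ A′ ∣ + ∣ X ∣
  size = begin
    ∣ V H ∣                    ≡⟨ sym (∣p─q∣+∣q∣≡∣p∣ (V H) X X⊆V) ⟩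
    ∣ W ∣ + ∣ X ∣              ≤⟨ +-monoˡ-≤ ∣ X ∣ (p⊆q⇒∣p∣≤∣q∣ W⊆A∪A′) ⟩
    ∣ A ∪ A′ ∣ + ∣ X ∣          ≡⟨ cong (_+ ∣ X ∣) (∣p∪q∣≡∣p∣+∣q∣ A A′ disj) ⟩
    ∣ A ∣ + ∣ A′ ∣ + ∣ X ∣      ∎
    where open ≤-Reasoning

-- Nonempty subsets of the two sides still separate: an edge within `A′ ∪ B′` lies in one old side,
-- and disjointness keeps it out of the opposite new side. Hence every total from 2 up to the
-- present one is attained.
separation-shrink : ∀ {m} → Separation H A B → 2 ≤ m → m ≤ ∣ A ∣ + ∣ B ∣ →
                    ∃₂ λ A′ B′ → Separation H A′ B′ × ∣ A′ ∣ + ∣ B′ ∣ ≡ m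
separation-shrink {H = H} {A} {B} {suc m} S (s≤s 1≤m) m≤ = result (split (m ≤? ∣ A ∣))
  where
  open Separation S
  split : Dec (m ≤ ∣ A ∣) → ∃₂ λ a b → (1 ≤ a × a ≤ ∣ A ∣) × (1 ≤ b × b ≤ ∣ B ∣) × a + b ≡ suc m
  -- The target total is `suc m`. If `A` is large enough, a single vertex of `B` is kept; otherwise
  -- all of `A` is kept and `B` supplies the remainder.
  split (yes m≤a) = m , 1 , (1≤m , m≤a) , (s≤s z≤n , nonempty⇒1≤∣p∣ B-ne) , +-comm m 1
  split (no m≰a)  =
    let a<m = ≰⇒> m≰a
        a≤m = ≤-trans (<⇒≤ a<m) (n≤1+n m)
    in  ∣ A ∣ , suc m ∸ ∣ A ∣ , (nonempty⇒1≤∣p∣ A-ne , ≤-refl) ,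
        (m<n⇒0<n∸m (≤-trans a<m (n≤1+n m)) , m≤n+o⇒m∸n≤o (suc m) ∣ A ∣ m≤) , m+[n∸m]≡n a≤m
  result : (∃₂ λ a b → (1 ≤ a × a ≤ ∣ A ∣) × (1 ≤ b × b ≤ ∣ B ∣) × a + b ≡ suc m) →
           ∃₂ λ A′ B′ → Separation H A′ B′ × ∣ A′ ∣ + ∣ B′ ∣ ≡ suc m
  result (a , b , (1≤a , a≤) , (1≤b , b≤) , a+b≡) with subsetOfSize A a≤ | subsetOfSize B b≤
  ... | A′ , A′⊆ , refl | B′ , B′⊆ , refl = A′ , B′ , record
    { A⊆V = ⊆-trans A′⊆ A⊆V
    ; B⊆V = ⊆-trans B′⊆ B⊆V
    ; A-ne = 1≤∣p∣⇒nonempty 1≤a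
    ; B-ne = 1≤∣p∣⇒nonempty 1≤b
    ; disjoint = λ x∈A x∈B → disjoint (A′⊆ x∈A) (B′⊆ x∈B)
    ; separates = sep
    } , a+b≡
    where
    sep : ∀ {f} → f ∈ᴸ E H → f ⊆ A′ ∪ B′ → f ⊆ A′ ⊎ f ⊆ B′
    sep f∈ f⊆ with separates f∈ (⊆-trans f⊆ (∪-mono A′⊆ B′⊆))
    ... | inj₁ f⊆A = inj₁ λ x∈f →
      [ id , (λ x∈B′ → contradiction (B′⊆ x∈B′) (disjoint (f⊆A x∈f))) ] (x∈p∪q⁻ A′ B′ (f⊆ x∈f))
    ... | inj₂ f⊆B = inj₂ λ x∈f →
      [ (λ x∈A′ → contradiction (f⊆B x∈f) (disjoint (A′⊆ x∈A′))) , id ] (x∈p∪q⁻ A′ B′ (f⊆ x∈f))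

-- Connectivity against a separation

-- Deleting a vertex-cut leaves something disconnected, hence at least one vertex.
κ≤∣V∣∸1 : (H : Hypergraph N) → κ H ≤ ∣ V H ∣ ∸ 1
κ≤∣V∣∸1 H with κ-spec H
... | inj₂ (_ , eq) = ≤-reflexive eq
... | inj₁ ((X , (X⊆V , ¬c) , eq) , _) with disconnected⇒∃¬path (H -ᵛ X) ¬c
...   | u , _ , u∈ , _ = ≤-trans (≤-reflexive (sym eq)) (m+n≤o⇒m≤o∸n ∣ X ∣ (begin
  ∣ X ∣ + 1            ≤⟨ +-monoʳ-≤ ∣ X ∣ (nonempty⇒1≤∣p∣ (u , u∈)) ⟩
  ∣ X ∣ + ∣ V H ─ X ∣  ≡⟨ +-comm ∣ X ∣ _ ⟩
  ∣ V H ─ X ∣ + ∣ X ∣  ≡⟨ ∣p─q∣+∣q∣≡∣p∣ (V H) X X⊆V ⟩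
  ∣ V H ∣              ∎))
  where open ≤-Reasoning

walk-closed : (∀ {f x} → f ∈ᴸ E H → x ∈ f → x ∈ A → f ⊆ A) → Walk H u v vs es → u ∈ A → v ∈ A
walk-closed closed (stop _)            u∈A = u∈A
walk-closed closed (step e∈ u∈e w∈e W) u∈A = walk-closed closed W (closed e∈ u∈e u∈A w∈e)

Avoids : Subset N → Subset N → Set
Avoids p q = ∀ x → x ∈ p → x ∉ q

-- Suppose `K` meets both sides, and delete its vertices outside `A ∪ B`. They are fewer than `κ K`,
-- so they form no vertex-cut; but no edge of what remains leaves `A`, so no walk leads from `A` to
-- `B`.
highly-connected-side : (K : Hypergraph N) → ∣ V K ─ (A ∪ B) ∣ < κ K →
  (∀ {x} → x ∈ A → x ∉ B) → (∀ {f} → f ∈ᴸ E K → f ⊆ A ∪ B → f ⊆ A ⊎ f ⊆ B) →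
  Avoids (V K) A ⊎ Avoids (V K) B
highly-connected-side {A = A} {B} K small disj sep
  with anyᶠ? (λ x → (x ∈? V K) ×-dec (x ∈? A)) | anyᶠ? (λ x → (x ∈? V K) ×-dec (x ∈? B))
... | no ¬A | _     = inj₁ λ _ x∈ x∈A → ¬A (_ , x∈ , x∈A)
... | _     | no ¬B = inj₂ λ _ x∈ x∈B → ¬B (_ , x∈ , x∈B)
... | yes (a , a∈ , a∈A) | yes (b , b∈ , b∈B) with connected? (K -ᵛ (V K ─ (A ∪ B)))
...   | no ¬c = contradiction small (≤⇒≯ (κ-minimal (κ-spec K)))
  where
  cut : IsVertexCut K (V K ─ (A ∪ B))
  cut = p─q⊆p (V K) (A ∪ B) , ¬c
  κ-minimal : ∀ {m} → IsConnectivity K m → m ≤ ∣ V K ─ (A ∪ B) ∣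
  κ-minimal (inj₁ (_ , min))  = min _ cut
  κ-minimal (inj₂ (none , _)) = contradiction (_ , cut) none
...   | yes c = let (_ , _ , W , _) = c a b (left a∈ (inj₁ a∈A)) (left b∈ (inj₂ b∈B))
                in  contradiction b∈B (disj (walk-closed closed W a∈A))
  where
  Y = V K ─ (A ∪ B)
  left : ∀ {x} → x ∈ V K → x ∈ A ⊎ x ∈ B → x ∈ V K ─ Y
  left x∈ x∈AB = x∈p∧x∉q⇒x∈p─q x∈ λ x∈Y → x∈p─q⇒x∉q (V K) (A ∪ B) x∈Y (x∈p∪q⁺ x∈AB)
  ⊆A∪B : V K ─ Y ⊆ A ∪ B
  ⊆A∪B {x} x∈ = decidable-stable (x ∈? A ∪ B) λ x∉ →
    x∈p─q⇒x∉q (V K) Y x∈ (x∈p∧x∉q⇒x∈p─q (p─q⊆p (V K) Y x∈) x∉)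
  closed : ∀ {f x} → f ∈ᴸ E (K -ᵛ Y) → x ∈ f → x ∈ A → f ⊆ A
  closed f∈ x∈f x∈A with ∈-filter⁻ (_⊆? (V K ─ Y)) {xs = E K} f∈
  ... | f∈K , f⊆ with sep f∈K (⊆-trans f⊆ ⊆A∪B)
  ...   | inj₁ f⊆A = f⊆A
  ...   | inj₂ f⊆B = contradiction (f⊆B x∈f) (disj x∈A)

-- Critical non-edges when a side is deleted

Critical : ℕ → ℕ → Hypergraph N → Subset N → Set
Critical k r H e = ∃₂ λ (c : ComplementEdge r H e) K → K ⊑ addEdge H e c × suc k ≤ κ K

-- This is `κ̄ H ≤ k` unfolded, a form that passes directly to subhypergraphs. `Critical` likewise
-- names its `K`, because the same `K` remains the witness after a side is deleted.
Bounded : ℕ → Hypergraph N → Set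
Bounded k H = ∀ K → K ⊑ H → κ K ≤ k

-ᵛ-⊑ : (H : Hypergraph N) (X : Subset N) → (H -ᵛ X) ⊑ H
-ᵛ-⊑ H X = p─q⊆p (V H) X , proj₁ ∘ ∈-filter⁻ (_⊆? (V H ─ X)) {xs = E H}

bounded-⊑ : K ⊑ H → Bounded k H → Bounded k K
bounded-⊑ (V⊆ , E⊆) bd L (V⊆′ , E⊆′) = bd L (⊆-trans V⊆′ V⊆ , E⊆ ∘ E⊆′)

-- `K` contains the edge `e`, since otherwise `K ⊑ H` and `κ K ≤ k`. As `K` avoids `B`, so do `e`
-- and all other edges of `K`, which places `K` inside `H -ᵛ B` with `e` added.
critical-delete : (c : ComplementEdge r H e) → Bounded k H → K ⊑ addEdge H e c → suc k ≤ κ K →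
                  Avoids (V K) B → Critical k r (H -ᵛ B) e
critical-delete {r = r} {H = H} {e} {K = K} {B} c bd (V⊆ , E⊆) κK avoid = c′ , K , (V⊆′ , E⊆′) , κK
  where
  V⊆′ : V K ⊆ V H ─ B
  V⊆′ x∈ = x∈p∧x∉q⇒x∈p─q (V⊆ x∈) (avoid _ x∈)
  edge⊆ : ∀ {f} → f ∈ᴸ E K → f ⊆ V H ─ B
  edge⊆ f∈ = ⊆-trans (All.lookup (E-within K) f∈) V⊆′
  e∈K : e ∈ᴸ E K
  e∈K with e ∈ᴸ? E K
  ... | yes e∈ = e∈
  ... | no e∉  = contradiction κK (≤⇒≯ (bd K (V⊆ , λ f∈ → case E⊆ f∈ of λ where
    (here refl) → contradiction f∈ e∉
    (there f∈H) → f∈H)))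
  c′ : ComplementEdge r (H -ᵛ B) e
  c′ = record
    { nonempty = ComplementEdge.nonempty c
    ; within   = edge⊆ e∈K
    ; size     = ComplementEdge.size c
    ; new      = ComplementEdge.new c ∘ proj₂ (-ᵛ-⊑ H B)
    }
  E⊆′ : E K ⊆ᴸ e ∷ E (H -ᵛ B)
  E⊆′ f∈ with E⊆ f∈
  ... | here refl = here refl
  ... | there f∈H = there (∈-filter⁺ (_⊆? (V H ─ B)) f∈H (edge⊆ f∈))

-- Exactly `k` vertices of `H` lie outside `A ∪ B`, so at most `k` of `K` do, fewer than `κ K`. The
-- sides still separate `K`: its only possible edge outside `H` is `e`, which does not cross.
critical-split : Separation H A B → ∣ A ∣ + ∣ B ∣ + k ≡ ∣ V H ∣ → Bounded k H →
                 Critical k r H e → ¬ Crossing A B e →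
                 Critical k r (H -ᵛ B) e ⊎ Critical k r (H -ᵛ A) e
critical-split {H = H} {A} {B} {k} {e = e} S size bd (c , K , K⊑ , κK) ¬cross =
  [ inj₂ ∘ critical-delete {H = H} c bd K⊑ κK , inj₁ ∘ critical-delete {H = H} c bd K⊑ κK ]
    (highly-connected-side {A = A} {B} K (<-≤-trans (s≤s small) κK) disjoint sep)
  where
  open Separation S
  small : ∣ V K ─ (A ∪ B) ∣ ≤ k
  small = +-cancelʳ-≤ ∣ A ∪ B ∣ _ _ (begin
    ∣ V K ─ (A ∪ B) ∣ + ∣ A ∪ B ∣
      ≤⟨ +-monoˡ-≤ ∣ A ∪ B ∣ (p⊆q⇒∣p∣≤∣q∣ λ x∈ →
           x∈p∧x∉q⇒x∈p─q (proj₁ K⊑ (p─q⊆p (V K) (A ∪ B) x∈)) (x∈p─q⇒x∉q (V K) (A ∪ B) x∈)) ⟩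
    ∣ V H ─ (A ∪ B) ∣ + ∣ A ∪ B ∣  ≡⟨ ∣p─q∣+∣q∣≡∣p∣ (V H) (A ∪ B) (p∪q⊆ A⊆V B⊆V) ⟩
    ∣ V H ∣                        ≡⟨ sym size ⟩
    ∣ A ∣ + ∣ B ∣ + k              ≡⟨ cong (_+ k) (sym (∣p∪q∣≡∣p∣+∣q∣ A B disjoint)) ⟩
    ∣ A ∪ B ∣ + k                  ≡⟨ +-comm ∣ A ∪ B ∣ k ⟩
    k + ∣ A ∪ B ∣                  ∎)
    where open ≤-Reasoning
  sep : ∀ {f} → f ∈ᴸ E K → f ⊆ A ∪ B → f ⊆ A ⊎ f ⊆ B
  sep f∈ f⊆ with proj₂ K⊑ f∈
  ... | there f∈H = separates f∈H f⊆
  ... | here refl with e ⊆? A | e ⊆? B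
  ...   | yes e⊆A | _       = inj₁ e⊆A
  ...   | no _    | yes e⊆B = inj₂ e⊆B
  ...   | no e⊈A  | no e⊈B  = ⊥-elim (¬cross (f⊆ , e⊈A , e⊈B))

-- With at least `k + 2` vertices, the default value `∣ V H ∣ ∸ 1` exceeds `k`, so `κ H` comes from
-- an actual vertex-cut. Its sides total at least `∣ V H ∣ ∸ k ≥ 2` vertices and are shrunk to
-- exactly that many.
bounded⇒separation : (H : Hypergraph N) → Bounded k H → suc (suc k) ≤ ∣ V H ∣ →
                     ∃₂ λ A B → Separation H A B × ∣ A ∣ + ∣ B ∣ + k ≡ ∣ V H ∣
bounded⇒separation {k = k} H bd 2+k≤n = result (κ-spec H)
  where
  κ≤k : κ H ≤ k
  κ≤k = bd H (id , id)
  k≤n : k ≤ ∣ V H ∣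
  k≤n = m+n≤o⇒n≤o 2 2+k≤n
  result : IsConnectivity H (κ H) → ∃₂ λ A B → Separation H A B × ∣ A ∣ + ∣ B ∣ + k ≡ ∣ V H ∣
  result (inj₂ (_ , κ≡)) = contradiction (begin-strict
    k            <⟨ ∸-monoˡ-≤ 1 2+k≤n ⟩
    ∣ V H ∣ ∸ 1  ≡⟨ sym κ≡ ⟩
    κ H          ≤⟨ κ≤k ⟩
    k            ∎) (<-irrefl refl)
    where open ≤-Reasoning
  result (inj₁ ((X , cut , ∣X∣≡κ) , _)) =
    let (A , B , S , n≤)   = cut⇒separation {H = H} cut
        (A′ , B′ , S′ , eq) = separation-shrink S 2≤n∸k (enough n≤)
    in  A′ , B′ , S′ , trans (cong (_+ k) eq) (m∸n+n≡m k≤n)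
    where
    open ≤-Reasoning
    2≤n∸k : 2 ≤ ∣ V H ∣ ∸ k
    2≤n∸k = m+n≤o⇒m≤o∸n 2 2+k≤n
    enough : ∀ {m} → ∣ V H ∣ ≤ m + ∣ X ∣ → ∣ V H ∣ ∸ k ≤ m
    enough {m} n≤ = m≤n+o⇒m∸n≤o ∣ V H ∣ k (begin
      ∣ V H ∣    ≤⟨ n≤ ⟩
      m + ∣ X ∣  ≡⟨ cong (m +_) ∣X∣≡κ ⟩
      m + κ H    ≤⟨ +-monoʳ-≤ m κ≤k ⟩
      m + k      ≡⟨ +-comm m k ⟩
      k + m      ∎)

-- Counting critical non-edges by induction

-- The recursion is on the bound `m`, since `H -ᵛ Q` is not structurally smaller than `H`. The list
-- `L` is arbitrary, which avoids having to enumerate the critical non-edges.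
critical-count : ∀ m → 1 ≤ r → (H : Hypergraph N) → ∣ V H ∣ ≤ m → Bounded k H →
                 ∀ {L} → Unique L → All (Critical k r H) L → length L ≤ (∣ V H ∣ ∸ k) C r
critical-count {r = r} {k = k} m 1≤r H n≤m bd {L} uL crit with suc (suc k) ≤? ∣ V H ∣
critical-count m 1≤r H n≤m bd uL [] | no _ = z≤n
-- Here `∣ V H ∣ ≤ k + 1`, so `κ K ≤ ∣ V K ∣ ∸ 1 ≤ k`, and `L` cannot have a first element.
critical-count m 1≤r H n≤m bd uL ((c , K , K⊑ , κK) ∷ _) | no n≱ =
  contradiction (≤-trans κK (≤-trans (κ≤∣V∣∸1 K)
    (≤-trans (∸-monoˡ-≤ 1 (p⊆q⇒∣p∣≤∣q∣ (proj₁ K⊑))) (∸-monoˡ-≤ 1 (s≤s⁻¹ (≰⇒> n≱)))))) 1+n≰n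
critical-count zero 1≤r H n≤0 bd uL crit | yes 2+k≤n = contradiction (≤-trans 2+k≤n n≤0) λ ()
critical-count {r = r} {k = k} (suc m) 1≤r H n≤m bd {L} uL crit | yes 2+k≤n
  with bounded⇒separation H bd 2+k≤n
... | A , B , S , size
  with unique-split uL (All.map (λ {e} → classify e) crit)
  where
  classify : ∀ e → Critical k r H e → (Crossing A B e × ∣ e ∣ ≡ r) ⊎
             (Critical k r (H -ᵛ B) e ⊎ Critical k r (H -ᵛ A) e)
  classify e cr with crossing? A B e
  ... | yes cross = inj₁ (cross , ComplementEdge.size (proj₁ cr))
  ... | no ¬cross = inj₂ (critical-split {H = H} S size bd cr ¬cross)
... | L₁ , L′ , (u₁ , cross , _) , (u′ , crit′ , _) , eq
  with unique-split u′ crit′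
... | L₂ , L₃ , (u₂ , critA , _) , (u₃ , critB , _) , eq′ = begin
  length L                                ≡⟨ trans eq (cong (length L₁ +_) eq′) ⟩
  length L₁ + (length L₂ + length L₃)     ≤⟨ +-monoʳ-≤ (length L₁) (+-mono-≤
                                               (side S size critA u₂)
                                               (side (separation-swap S) size′ critB u₃)) ⟩
  length L₁ + (∣ A ∣ C r + ∣ B ∣ C r)     ≤⟨ crossing-count disjoint 1≤r u₁ cross ⟩
  (∣ A ∣ + ∣ B ∣) C r                     ≡⟨ cong (_C r) (sym (m+n∸n≡m (∣ A ∣ + ∣ B ∣) k)) ⟩
  (∣ A ∣ + ∣ B ∣ + k ∸ k) C r             ≡⟨ cong (λ n → (n ∸ k) C r) size ⟩
  (∣ V H ∣ ∸ k) C r                       ∎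
  where
  open ≤-Reasoning
  open Separation S using (disjoint)
  size′ : ∣ B ∣ + ∣ A ∣ + k ≡ ∣ V H ∣
  size′ = trans (cong (_+ k) (+-comm ∣ B ∣ ∣ A ∣)) size
  -- Deleting `Q` leaves `∣ P ∣ + k` vertices, so the inductive bound becomes `∣ P ∣ C r`. The count
  -- drops strictly because `Q` is nonempty.
  side : ∀ {P Q L} → Separation H P Q → ∣ P ∣ + ∣ Q ∣ + k ≡ ∣ V H ∣ →
         All (Critical k r (H -ᵛ Q)) L → Unique L → length L ≤ ∣ P ∣ C r
  side {P} {Q} {L} T sz cr u = subst (λ n → length L ≤ n C r)
    (trans (cong (_∸ k) n′≡) (m+n∸n≡m ∣ P ∣ k))
    (critical-count m 1≤r (H -ᵛ Q) n′≤m (bounded-⊑ {K = H -ᵛ Q} {H = H} (-ᵛ-⊑ H Q) bd) u cr)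
    where
    open Separation T
    n≡ : ∣ V H ─ Q ∣ + ∣ Q ∣ ≡ ∣ V H ∣
    n≡ = ∣p─q∣+∣q∣≡∣p∣ (V H) Q B⊆V
    n′≡ : ∣ V H ─ Q ∣ ≡ ∣ P ∣ + k
    n′≡ = +-cancelʳ-≡ ∣ Q ∣ _ _ (trans n≡ (trans (sym sz)
      (trans (+-assoc (∣ P ∣) (∣ Q ∣) k) (trans (cong (∣ P ∣ +_) (+-comm ∣ Q ∣ k)) (sym (+-assoc (∣ P ∣) k (∣ Q ∣)))))))
    n′≤m : ∣ V H ─ Q ∣ ≤ m
    n′≤m = s≤s⁻¹ (begin
      suc ∣ V H ─ Q ∣       ≡⟨ +-comm 1 _ ⟩
      ∣ V H ─ Q ∣ + 1       ≤⟨ +-monoʳ-≤ _ (nonempty⇒1≤∣p∣ B-ne) ⟩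
      ∣ V H ─ Q ∣ + ∣ Q ∣   ≡⟨ n≡ ⟩
      ∣ V H ∣               ≤⟨ n≤m ⟩
      suc m                 ∎)

-- From critical non-edges to the number of edges

theorem3p2 : ∀ (n k r : ℕ) → k ≥ 2 → r ≥ 2 → n ≥ k + 1 →
    ∀ {N} (H : Hypergraph N) → ∣ V H ∣ ≡ n → VertexMaximal k r H →
    length (E H) ≥ (n C r) ∸ ((n ∸ k) C r)
theorem3p2 n k r k≥2 r≥2 n≥k+1 H refl vm =
  -- With the subtraction moved across, the `r`-subsets of `V H` are counted as non-edges, listed in
  -- `L`, together with edges.
  m≤n+o⇒m∸n≤o _ ((n ∸ k) C r) (begin
    n C r                          ≡⟨ sym (length-subsets r (V H)) ⟩
    length (subsets r (V H))       ≤⟨ unique-⊆⇒length≤ (subsets-unique r (V H)) covered ⟩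
    length (L ++ E H)              ≡⟨ length-++ L ⟩
    length L + length (E H)        ≤⟨ +-monoˡ-≤ _ (critical-count n 1≤r H ≤-refl bd
                                        (Unique.filter⁺ new? (subsets-unique r (V H))) (All.tabulate critical)) ⟩
    (n ∸ k) C r + length (E H)     ∎)
  where
  open ≤-Reasoning
  open VertexMaximal vm
  1≤r = ≤-trans (s≤s z≤n) r≥2
  new? = λ e → ¬? (e ∈ᴸ? E H)
  L = filter new? (subsets r (V H))
  covered : subsets r (V H) ⊆ᴸ L ++ E H
  covered {e} e∈ with e ∈ᴸ? E H
  ... | yes e∈H = ∈-++⁺ʳ L e∈H
  ... | no e∉H  = ∈-++⁺ˡ (∈-filter⁺ new? e∈ e∉H)
  bd : Bounded k H
  bd K K⊑H = ≤-trans (proj₂ (κ̄-spec H) K K⊑H) bounded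
  critical : ∀ {e} → e ∈ᴸ L → Critical k r H e
  critical {e} e∈L with ∈-filter⁻ new? {xs = subsets r (V H)} e∈L
  ... | e∈ , e∉H with ∈-subsets⁻ r (V H) e∈
  ...   | e⊆ , ∣e∣≡r =
    let c : ComplementEdge r H e
        c = record
          { nonempty = 1≤∣p∣⇒nonempty (subst (1 ≤_) (sym ∣e∣≡r) 1≤r)
          ; within   = e⊆
          ; size     = ∣e∣≡r
          ; new      = e∉H
          }
        -- The subhypergraph attaining `κ̄` of `H` with `e` added is the witness that `e` is
        -- critical; `maximal` gives its connectivity.
        ((K , K⊑ , κK≡) , _) = κ̄-spec (addEdge H e c)
    in  c , K , K⊑ , ≤-trans (maximal e c) (≤-reflexive (sym κK≡))
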